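{- A map is orientable if and only if it has an $R$-coloring, where $R=\{0,1,2\}$.
   Context: Map. A map $\mathcal{M}$ is an embedding of a graph (or pseudograph) on a compact connected surface such that the components of the complement (faces) are open disks. Choose a center in each face and a midpoint in each edge, and join each face-center to each incidence with the surrounding vertices and edge-midpoints; this divides the surface into triangles called flags. Combinatorially, a map is a pair $(\Omega,[r_0,r_1,r_2])$ where $\Omega$ is the (finite, since the surface is compact) set of flags, $r_0,r_1,r_2$ are permutations of $\Omega$ (acting on the right), $r_0,r_1,r_2$ and $r_0r_2$ are fixed-point-free of order 2, $r_0r_2=r_2r_0$, and $\langle r_0,r_1,r_2\rangle$ is transitive on $\Omega$. Here $fr_0$, $fr_1$, $fr_2$ are the flags sharing with $f$ the side joining edge-midpoint to face-center, the side joining face-center to vertex, and the side joining vertex to edge-midpoint, respectively; the surface is recovered by taking one triangle for each flag and gluing along these sides. Orientable. A map is orientable if the surface on which it is embedded is orientable; equivalently, if it has a face orientation, i.e. an assignment of a circular arrow (direction of rotation) to each face such that at every edge the arrows on the faces joined by the edge point along the edge in opposite directions. Coloring. An $R$-coloring of $\mathcal{M}$ is a function $a:\Omega\to\mathbb{Z}_2$ such that $a(fr_j)\neq a(f)$ for every flag $f$ and every $j\in\{0,1,2\}$. -}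

module Defs where

open import Data.Fin.Base using (Fin)
open import Data.Fin.Patterns using (0F; 1F; 2F)
open import Data.Product.Base using (∃-syntax)
open import Data.Sum.Base using (_⊎_)
open import Function.Bundles using (_↔_; Func)
open import Relation.Binary.Bundles using (Setoid)
open import Relation.Binary.Construct.Closure.Equivalence using (EqClosure; setoid)
open import Relation.Binary.PropositionalEquality using (_≡_; _≢_)

-- The index set {0,1,2} of the connectors r₀, r₁, r₂.
R : Set
R = Fin 3

ℤ₂ : Set
ℤ₂ = Fin 2

record Map : Set₁ where
  infixl 20 _·_
  field
    Ω        : Set
    finite   : ∃[ n ] (Ω ↔ Fin n)
    -- A surface is nonempty, and r₀, r₁, r₂ have order exactly 2.
    nonempty : Ω
    -- f · j is f rⱼ: permutations act on the right, so f · 0F · 2F is f r₀ r₂.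
    _·_      : Ω → R → Ω
    -- In particular every rⱼ is a permutation of Ω.
    involutive         : ∀ f j → f · j · j ≡ f
    fixedPointFree     : ∀ f j → f · j ≢ f
    r₀r₂≡r₂r₀          : ∀ f → f · 0F · 2F ≡ f · 2F · 0F
    r₀r₂fixedPointFree : ∀ f → f · 0F · 2F ≢ f
    -- The orbits of a permutation group are the classes of the equivalence
    -- relation generated by single applications of its generators.
    transitive : ∀ f g → EqClosure (λ h k → ∃[ j ] k ≡ h · j) f g

module _ (M : Map) where
  open Map M

  -- Faces are the orbits of ⟨r₀, r₁⟩: crossing the sides of a flag that meet the
  -- face-center. A face is represented by any of its flags.
  Faces : Setoid _ _
  Faces = setoid (λ f g → (g ≡ f · 0F) ⊎ (g ≡ f · 1F))

  -- Circular arrows. The flag f represents the rotation, about the center of its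
  -- face, that passes along the edge of f from the vertex of f to the vertex of
  -- f r₀. Beyond that vertex the rotation continues along the next edge of the
  -- face, from the vertex of f r₀ r₁ (which is that of f r₀). So f and g represent
  -- the same rotation when they lie in the same orbit of ⟨r₀ r₁⟩; the opposite
  -- rotation of the face is represented by f r₀. This also covers faces of degree
  -- one, where f r₀ = f r₁.
  Rotations : Setoid _ _
  Rotations = setoid (λ f g → g ≡ f · 0F · 1F)

  record FaceOrientation : Set where
    field
      -- As a morphism of setoids, the arrow depends only on the face.
      arrow  : Func Faces Rotations
      onFace : ∀ f → Setoid._≈_ Faces (Func.to arrow f) f

    -- The arrow on the face of f points along the edge of f from the vertex of f
    -- to the vertex of f r₀, on the side of the edge where f lies.
    PointsAlong : Ω → Set
    PointsAlong f = Setoid._≈_ Rotations (Func.to arrow f) f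

    field
      -- f r₂ is across the edge of f, at the same vertex, so pointing the opposite
      -- way on that side is pointing from the vertex of f r₀ r₂ to that of f r₂.
      -- The two sides of the edge may belong to one and the same face.
      opposite : ∀ f → PointsAlong f → PointsAlong (f · 0F · 2F)

  Orientable : Set
  Orientable = FaceOrientation

  IsRColoring : (Ω → ℤ₂) → Set
  IsRColoring a = ∀ f j → a (f · j) ≢ a f

  HasRColoring : Set
  HasRColoring = ∃[ a ] IsRColoring a

{-# OPTIONS --safe #-}
module Submission where

-- The faces are the orbits of the dihedral group ⟨r₀, r₁⟩, the rotations those of
-- its cyclic subgroup ⟨r₀ r₁⟩. Every face carries exactly two rotations: that of f
-- and that of f r₀ cover the face of f (rotationOfFace), and they differ because a
-- coincidence f r₀ = f (r₀ r₁)ⁿ would make f a fixed point of r₀ (r₀ r₁)⁻ⁿ, which is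
-- a conjugate of r₀ or of r₁ (rotation≢reverse).
--
-- Given a face orientation, color f with 0 when the arrow on its face points along
-- f, and with 1 otherwise. Of the two rotations of a face exactly one is its arrow,
-- so r₀ changes the color; f r₁ has the rotation of f r₀, so r₁ changes it too. The
-- condition at the edges says that f r₀ r₂ has color 0 whenever f does, hence
-- exactly when f does, since r₀ r₂ is an involution. So f r₀ r₂ has the color of f;
-- r₀ commutes with r₂ and changes the color, so r₂ changes it as well.
--
-- Given an R-coloring, the color is constant on each rotation, and the two
-- rotations of a face have different colors. Let the arrow of each face be its
-- rotation of color 0. As f r₀ r₂ has the color of f, the arrows on the two sides of
-- an edge are opposite.
--
-- The coloring is decidable because rotationOfFace computes which of the two
-- rotations of its face the arrow is.

open import Defs
open import Data.Empty using (⊥-elim)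
open import Data.Fin.Patterns using (0F; 1F; 2F)
open import Data.Nat.Base using (ℕ; zero; suc)
open import Data.Nat.GeneralisedArithmetic using (iterate)
open import Data.Product.Base using (_×_; _,_; ∃-syntax)
open import Data.Sum.Base using (_⊎_; inj₁; inj₂)
open import Function.Base using (_∘_; id)
open import Function.Bundles using (_⇔_; mk⇔; Func)
open import Relation.Binary.Bundles using (Setoid)
import Relation.Binary.Construct.Closure.Equivalence as EqC
open import Relation.Binary.Construct.Closure.Equivalence using (EqClosure)
open import Relation.Binary.Construct.Closure.ReflexiveTransitive using (ε; _◅_)
open import Relation.Binary.Construct.Closure.Symmetric as SymC using (fwd; bwd)
open import Relation.Binary.PropositionalEquality
  using (_≡_; _≢_; refl; sym; trans; cong; subst; isEquivalence)
open import Relation.Nullary using (¬_; Dec; yes; no)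

-- Orbits of an injective function

module _ {A : Set} (s : A → A) where

  iterate-suc : ∀ n x → iterate s x (suc n) ≡ s (iterate s x n)
  iterate-suc zero    x = refl
  iterate-suc (suc n) x = iterate-suc n (s x)

  -- Injectivity lets a step back cancel a step forward, so that a zigzag between two
  -- points straightens to iteration in one direction.
  orbit⇒iterate : (∀ {x y} → s x ≡ s y → x ≡ y) →
                  ∀ {x y} → EqClosure (λ x y → y ≡ s x) x y →
                  (∃[ n ] y ≡ iterate s x n) ⊎ (∃[ n ] x ≡ iterate s y n)
  orbit⇒iterate inj ε = inj₁ (0 , refl)
  orbit⇒iterate inj (fwd refl ◅ p) with orbit⇒iterate inj p
  ... | inj₁ (n , y≡)         = inj₁ (suc n , y≡)
  ... | inj₂ (zero , sx≡y)    = inj₁ (1 , sym sx≡y)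
  ... | inj₂ (suc n , sx≡)    = inj₂ (n , inj (trans sx≡ (iterate-suc n _)))
  orbit⇒iterate inj (bwd refl ◅ p) with orbit⇒iterate inj p
  ... | inj₁ (zero , refl)    = inj₂ (1 , refl)
  ... | inj₁ (suc n , y≡)     = inj₁ (n , y≡)
  ... | inj₂ (n , x≡)         = inj₂ (suc n , trans (cong s x≡) (sym (iterate-suc n _)))

-- Two colors

≢-≢⇒≡ : ∀ {x y z : ℤ₂} → x ≢ y → y ≢ z → x ≡ z
≢-≢⇒≡ {0F} {_}  {0F} _   _   = refl
≢-≢⇒≡ {1F} {_}  {1F} _   _   = refl
≢-≢⇒≡ {0F} {0F} {1F} x≢y _   = ⊥-elim (x≢y refl)
≢-≢⇒≡ {0F} {1F} {1F} _   y≢z = ⊥-elim (y≢z refl)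
≢-≢⇒≡ {1F} {0F} {0F} _   y≢z = ⊥-elim (y≢z refl)
≢-≢⇒≡ {1F} {1F} {0F} x≢y _   = ⊥-elim (x≢y refl)

-- The color of a decided proposition: 0 if it holds, 1 if it fails.
color : {P : Set} → Dec P → ℤ₂
color (yes _) = 0F
color (no _)  = 1F

color-≢ : {P Q : Set} (P? : Dec P) (Q? : Dec Q) →
          ¬ (P × Q) → (¬ P → Q) → color P? ≢ color Q?
color-≢ (yes p) (yes q) ¬both _      _ = ¬both (p , q)
color-≢ (no ¬p) (no ¬q) _     either _ = ¬q (either ¬p)
color-≢ (yes _) (no _)  _     _      ()
color-≢ (no _)  (yes _) _     _      ()

module _ (M : Map) where
  open Map M
  private
    module F = Setoid (Faces M)
    module Rot = Setoid (Rotations M)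

  -- The two rotations of a face

  ·-injective : ∀ j {f g} → f · j ≡ g · j → f ≡ g
  ·-injective j {f} {g} eq =
    trans (sym (involutive f j)) (trans (cong (_· j) eq) (involutive g j))

  -- The generator r₀ r₁ of the rotations.
  rotate : Ω → Ω
  rotate f = f · 0F · 1F

  rotate-injective : ∀ {f g} → rotate f ≡ rotate g → f ≡ g
  rotate-injective = ·-injective 0F ∘ ·-injective 1F

  -- The equation f r₀ = f (r₀ r₁)ⁿ⁺¹ is g r₁ = g (r₀ r₁)ⁿ for g = f r₀ r₁, and
  -- f r₁ = f (r₀ r₁)ⁿ⁺¹ becomes f r₀ = f (r₀ r₁)ⁿ on cancelling the last r₁. The
  -- descent ends at a fixed point of r₀ or of r₁.
  mutual
    r₀≢rotation : ∀ n f → f · 0F ≢ iterate rotate f n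
    r₀≢rotation zero    f eq = fixedPointFree f 0F eq
    r₀≢rotation (suc n) f eq =
      r₁≢rotation n (rotate f) (trans (involutive (f · 0F) 1F) eq)

    r₁≢rotation : ∀ n f → f · 1F ≢ iterate rotate f n
    r₁≢rotation zero    f eq = fixedPointFree f 1F eq
    r₁≢rotation (suc n) f eq = r₀≢rotation n f
      (trans (cong (_· 0F) (·-injective 1F (trans eq (iterate-suc rotate n f))))
             (involutive _ 0F))

  rotation≢reverse : ∀ f → ¬ (f Rot.≈ f · 0F)
  rotation≢reverse f p with orbit⇒iterate rotate rotate-injective p
  ... | inj₁ (n , eq) = r₀≢rotation n f eq
  ... | inj₂ (n , eq) = r₀≢rotation n (f · 0F) (trans (involutive f 0F) eq)

  -- Crossing a side of a flag that meets the center of its face.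
  FaceStep : Ω → Ω → Set
  FaceStep f g = (g ≡ f · 0F) ⊎ (g ≡ f · 1F)

  FaceStep-sym : ∀ {f g} → FaceStep f g → FaceStep g f
  FaceStep-sym {f} (inj₁ refl) = inj₁ (sym (involutive f 0F))
  FaceStep-sym {f} (inj₂ refl) = inj₂ (sym (involutive f 1F))

  r₀-step : ∀ f → f F.≈ f · 0F
  r₀-step f = EqC.return (inj₁ refl)

  r₁-step : ∀ f → f F.≈ f · 1F
  r₁-step f = EqC.return (inj₂ refl)

  rotation-step : ∀ f → f Rot.≈ f · 0F · 1F
  rotation-step f = EqC.return refl

  r₀≈r₁ : ∀ f → f · 0F Rot.≈ f · 1F
  r₀≈r₁ f = subst (λ g → f · 0F Rot.≈ g · 1F) (involutive f 0F) (rotation-step (f · 0F))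

  -- Crossing a side within a face reverses the rotation.
  step-reverses : ∀ {f g} → FaceStep f g → f · 0F Rot.≈ g
  step-reverses     (inj₁ refl) = Rot.refl
  step-reverses {f} (inj₂ refl) = r₀≈r₁ f

  rotation⇒face : ∀ {f g} → f Rot.≈ g → f F.≈ g
  rotation⇒face = EqC.fold F.isEquivalence
    λ { {f} refl → F.trans (r₀-step f) (r₁-step (f · 0F)) }

  -- Each step of a path exchanges the two alternatives.
  rotationOfFace : ∀ {f g} → f F.≈ g → (g Rot.≈ f) ⊎ (g Rot.≈ f · 0F)
  rotationOfFace ε       = inj₁ Rot.refl
  rotationOfFace (s ◅ p) = cross (SymC.fold FaceStep-sym id s) (rotationOfFace p)
    where
    cross : ∀ {f f′ g} → FaceStep f f′ → (g Rot.≈ f′) ⊎ (g Rot.≈ f′ · 0F) →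
            (g Rot.≈ f) ⊎ (g Rot.≈ f · 0F)
    cross t (inj₁ q) = inj₂ (Rot.trans q (Rot.sym (step-reverses t)))
    cross t (inj₂ q) = inj₁ (Rot.trans q (step-reverses (FaceStep-sym t)))

  -- From face orientations to colorings

  module _ (O : FaceOrientation M) where
    open FaceOrientation O
    open Func arrow using (to) renaming (cong to arrow-cong)

    pointsAlong-resp : ∀ {f g} → f Rot.≈ g → PointsAlong f → PointsAlong g
    pointsAlong-resp f≈g p =
      Rot.trans (arrow-cong (F.sym (rotation⇒face f≈g))) (Rot.trans p f≈g)

    pointsAlong-r₀-excl : ∀ f → PointsAlong f → ¬ PointsAlong (f · 0F)
    pointsAlong-r₀-excl f p q =
      rotation≢reverse f (Rot.trans (Rot.sym p) (Rot.trans (arrow-cong (r₀-step f)) q))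

    pointsAlong-either : ∀ f → PointsAlong f ⊎ PointsAlong (f · 0F)
    pointsAlong-either f with rotationOfFace (F.sym (onFace f))
    ... | inj₁ p = inj₁ p
    ... | inj₂ q = inj₂ (Rot.trans (arrow-cong (F.sym (r₀-step f))) q)

    pointsAlong-r₀ : ∀ f → ¬ PointsAlong (f · 0F) → PointsAlong f
    pointsAlong-r₀ f ¬q with pointsAlong-either f
    ... | inj₁ p = p
    ... | inj₂ q = ⊥-elim (¬q q)

    pointsAlong? : ∀ f → Dec (PointsAlong f)
    pointsAlong? f with pointsAlong-either f
    ... | inj₁ p = yes p
    ... | inj₂ q = no λ p → pointsAlong-r₀-excl f p q

    opposite-r₂r₀ : ∀ f → PointsAlong f → PointsAlong (f · 2F · 0F)
    opposite-r₂r₀ f p = subst PointsAlong (r₀r₂≡r₂r₀ f) (opposite f p)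

    opposite-from-r₀ : ∀ f → PointsAlong (f · 0F) → PointsAlong (f · 2F)
    opposite-from-r₀ f q =
      subst (λ g → PointsAlong (g · 2F)) (involutive f 0F) (opposite (f · 0F) q)

    -- Color 0 marks the flags that the arrow of their face points along.
    coloring : Ω → ℤ₂
    coloring f = color (pointsAlong? f)

    coloring-isRColoring : IsRColoring M coloring
    coloring-isRColoring f j =
      color-≢ (pointsAlong? (f · j)) (pointsAlong? f) (λ (q , p) → ¬both j q p) (either j)
      where
      ¬both : ∀ j → PointsAlong (f · j) → ¬ PointsAlong f
      ¬both 0F q p = pointsAlong-r₀-excl f p q
      ¬both 1F q p = pointsAlong-r₀-excl f p (pointsAlong-resp (Rot.sym (r₀≈r₁ f)) q)
      ¬both 2F q p = pointsAlong-r₀-excl (f · 2F) q (opposite-r₂r₀ f p)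

      either : ∀ j → ¬ PointsAlong (f · j) → PointsAlong f
      either 0F ¬q = pointsAlong-r₀ f ¬q
      either 1F ¬q = pointsAlong-r₀ f (¬q ∘ pointsAlong-resp (r₀≈r₁ f))
      either 2F ¬q = pointsAlong-r₀ f (¬q ∘ opposite-from-r₀ f)

  -- From colorings to face orientations

  module _ (a : Ω → ℤ₂) (isColoring : IsRColoring M a) where

    two-steps : ∀ f i j → a (f · i · j) ≡ a f
    two-steps f i j = ≢-≢⇒≡ (isColoring (f · i) j) (isColoring f i)

    rotation⇒color≡ : ∀ {f g} → f Rot.≈ g → a f ≡ a g
    rotation⇒color≡ = EqC.gfold isEquivalence a λ { {f} refl → sym (two-steps f 0F 1F) }

    step-color≢ : ∀ {f g} → FaceStep f g → a g ≢ a f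
    step-color≢ {f} (inj₁ refl) = isColoring f 0F
    step-color≢ {f} (inj₂ refl) = isColoring f 1F

    -- For c the color of f, a flag of color 0 in the face of f: f itself or f r₀.
    select : ℤ₂ → Ω → Ω
    select 0F f = f
    select 1F f = f · 0F

    select-color : ∀ f → a (select (a f) f) ≡ 0F
    select-color f with a f in eq
    ... | 0F = eq
    ... | 1F = ≢-≢⇒≡ (subst (a (f · 0F) ≢_) eq (isColoring f 0F)) λ ()

    select-onFace : ∀ c f → select c f F.≈ f
    select-onFace 0F f = F.refl
    select-onFace 1F f = F.sym (r₀-step f)

    select-step : ∀ c d {f g} → FaceStep f g → d ≢ c → select c f Rot.≈ select d g
    select-step 0F 0F _ d≢c = ⊥-elim (d≢c refl)
    select-step 0F 1F t _   = Rot.sym (step-reverses (FaceStep-sym t))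
    select-step 1F 0F t _   = step-reverses t
    select-step 1F 1F _ d≢c = ⊥-elim (d≢c refl)

    -- The arrow of each face is its rotation of color 0.
    orientation : FaceOrientation M
    orientation = record
      { arrow = record
        { to   = λ f → select (a f) f
        ; cong = EqC.gfold Rot.isEquivalence (λ f → select (a f) f)
                   λ {f} {g} t → select-step (a f) (a g) t (step-color≢ t)
        }
      ; onFace   = λ f → select-onFace (a f) f
      ; opposite = λ f p → pointsAlong (f · 0F · 2F)
          (trans (two-steps f 0F 2F) (trans (sym (rotation⇒color≡ p)) (select-color f)))
      }
      where
      -- The arrow points along every flag of color 0.
      pointsAlong : ∀ f → a f ≡ 0F → select (a f) f Rot.≈ f
      pointsAlong f eq = Rot.reflexive (cong (λ c → select c f) eq)

proposition5p1 : (M : Map) → Orientable M ⇔ HasRColoring M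
proposition5p1 M = mk⇔
  (λ O → coloring M O , coloring-isRColoring M O)
  (λ (a , isColoring) → orientation M a isColoring)
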